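{- For every $\ell\in(0,1)$ there exists $k=k(\ell)\in\mathbb{N}$ such that for every circular arc $A\subset C$ of length $|A|=\ell$ on the circle $C=\mathbb{R}/\mathbb{Z}$ of unit length, there exist $k$ pairwise distinct constant speeds $v_1,\ldots,v_k>0$ and starting points $\beta_1,\ldots,\beta_k\in C$ with the following property: for $k$ runners moving along $C$ so that runner $i$ is at $f_i(t)=v_i t+\beta_i \bmod 1$ at time $t$, at every time $t\ge 0$ at least one of the $k$ runners is in the complement $C\setminus A$.
   Context: $C=[0,1)\bmod 1=\mathbb{R}/\mathbb{Z}$ is the circle of length $1$. A circular arc of $C$ is the image in $\mathbb{R}/\mathbb{Z}$ of an interval of $\mathbb{R}$ of positive length at most $1$; its length is the length of that interval. All runners run in the same (clockwise) direction, taken as the direction of increasing parameter. A runner with constant speed $v>0$ and starting point $\beta\in C$ is at position $vt+\beta \bmod 1$ at time $t\ge 0$. -}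

module Defs where

open import Data.Integer.Base as ℤ using (ℤ)
import Data.Integer.Properties as ℤ
open import Data.Nat.Base as ℕ using (ℕ; _⊔_)
import Data.Nat.Properties as ℕ
open import Data.Nat.Coprimality using (1-coprimeTo)
import Data.Nat.Coprimality as Coprime
open import Data.Product.Base using (∃-syntax; _×_; _,_; proj₁; proj₂)
open import Data.Rational.Base as ℚ using (ℚ; 0ℚ; 1ℚ; ½; ∣_∣; mkℚ)
import Data.Rational.Properties as ℚ
open import Data.Rational.Solver using (module +-*-Solver)
open import Level using (0ℓ)
open import Relation.Binary.Bundles using (Setoid)
open import Relation.Binary.PropositionalEquality
  using (_≡_; refl; sym; trans; cong; cong₂; subst)
open import Relation.Nullary.Negation using (¬_)

module _ where
  open +-*-Solver

  split-diff : ∀ a b c → a ℚ.- c ≡ (a ℚ.- b) ℚ.+ (b ℚ.- c)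
  split-diff = solve 3 (λ a b c → a :- c := (a :- b) :+ (b :- c)) refl

  diff-of-sums : ∀ a b c d → (a ℚ.+ b) ℚ.- (c ℚ.+ d) ≡ (a ℚ.- c) ℚ.+ (b ℚ.- d)
  diff-of-sums = solve 4
    (λ a b c d → (a :+ b) :- (c :+ d) := (a :- c) :+ (b :- d)) refl

  diff-of-products : ∀ a b c d →
    (a ℚ.* b) ℚ.- (c ℚ.* d) ≡ a ℚ.* (b ℚ.- d) ℚ.+ d ℚ.* (a ℚ.- c)
  diff-of-products = solve 4
    (λ a b c d → (a :* b) :- (c :* d) := a :* (b :- d) :+ d :* (a :- c)) refl

  swap-diff : ∀ a b → a ℚ.- b ≡ ℚ.- (b ℚ.- a)
  swap-diff = solve 2 (λ a b → a :- b := :- (b :- a)) refl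

  neg-diff : ∀ a b → (ℚ.- a) ℚ.- (ℚ.- b) ≡ ℚ.- (a ℚ.- b)
  neg-diff = solve 2 (λ a b → (:- a) :- (:- b) := :- (a :- b)) refl

  half+half : ∀ ε → ½ ℚ.* ε ℚ.+ ½ ℚ.* ε ≡ ε
  half+half = solve 1 (λ ε → con ½ :* ε :+ con ½ :* ε := ε) refl

  cancel-diff : ∀ a b → (a ℚ.- b) ℚ.+ b ≡ a
  cancel-diff = solve 2 (λ a b → (a :- b) :+ b := a) refl

0<½* : ∀ {ε} → 0ℚ ℚ.< ε → 0ℚ ℚ.< ½ ℚ.* ε
0<½* 0<ε = ℚ.*-monoʳ-<-pos ½ 0<ε

∣swap∣ : ∀ a b → ∣ a ℚ.- b ∣ ≡ ∣ b ℚ.- a ∣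
∣swap∣ a b = trans (cong ∣_∣ (swap-diff a b)) (ℚ.∣-p∣≡∣p∣ (b ℚ.- a))

∣+∣<-halves : ∀ {ε} a b → ∣ a ∣ ℚ.< ½ ℚ.* ε → ∣ b ∣ ℚ.< ½ ℚ.* ε → ∣ a ℚ.+ b ∣ ℚ.< ε
∣+∣<-halves {ε} a b a< b< = ℚ.≤-<-trans (ℚ.∣p+q∣≤∣p∣+∣q∣ a b)
  (subst (∣ a ∣ ℚ.+ ∣ b ∣ ℚ.<_) (half+half ε) (ℚ.+-mono-< a< b<))

/1-homo-+ : ∀ m n → (m ℤ.+ n) ℚ./ 1 ≡ m ℚ./ 1 ℚ.+ n ℚ./ 1
/1-homo-+ m n = sym (trans (cong₂ ℚ._+_ (/1≡ m) (/1≡ n))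
  (cong (ℚ._/ 1) (cong₂ ℤ._+_ (ℤ.*-identityʳ m) (ℤ.*-identityʳ n))))
  where
  /1≡ : ∀ i → i ℚ./ 1 ≡ mkℚ i 0 (Coprime.sym (1-coprimeTo ℤ.∣ i ∣))
  /1≡ i = ℚ.↥p/↧p≡p (mkℚ i 0 (Coprime.sym (1-coprimeTo ℤ.∣ i ∣)))

/1-homo-neg : ∀ n → (ℤ.- n) ℚ./ 1 ≡ ℚ.- (n ℚ./ 1)
/1-homo-neg n = inverseʳ-unique (n ℚ./ 1) ((ℤ.- n) ℚ./ 1)
  (trans (sym (/1-homo-+ n (ℤ.- n))) (cong (ℚ._/ 1) (ℤ.+-inverseʳ n)))
  where open import Algebra.Properties.Group ℚ.+-0-group using (inverseʳ-unique)

Cauchy : (ℕ → ℚ) → Set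
Cauchy x = ∀ ε → 0ℚ ℚ.< ε →
  ∃[ N ] ∀ m n → N ℕ.≤ m → N ℕ.≤ n → ∣ x m ℚ.- x n ∣ ℚ.< ε

record ℝ : Set where
  constructor mkℝ
  field
    seq    : ℕ → ℚ
    cauchy : Cauchy seq

open ℝ public

infix 4 _≃_ _<_ _≤_

_≃_ : ℝ → ℝ → Set
x ≃ y = ∀ ε → 0ℚ ℚ.< ε → ∃[ N ] ∀ n → N ℕ.≤ n → ∣ seq x n ℚ.- seq y n ∣ ℚ.< ε

-- A termwise strict inequality would not be invariant under _≃_: the gap has
-- to be bounded below by a fixed positive rational.
_<_ : ℝ → ℝ → Set
x < y = ∃[ ε ] 0ℚ ℚ.< ε × ∃[ N ] ∀ n → N ℕ.≤ n → seq x n ℚ.+ ε ℚ.< seq y n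

_≤_ : ℝ → ℝ → Set
x ≤ y = ∀ ε → 0ℚ ℚ.< ε → ∃[ N ] ∀ n → N ℕ.≤ n → seq x n ℚ.< seq y n ℚ.+ ε

fromℚ : ℚ → ℝ
fromℚ q = mkℝ (λ _ → q) λ ε 0<ε → 0 , λ _ _ _ _ →
  subst (ℚ._< ε) (sym (cong ∣_∣ (ℚ.+-inverseʳ q))) 0<ε

fromℤ : ℤ → ℝ
fromℤ n = fromℚ (n ℚ./ 1)

0ℝ 1ℝ : ℝ
0ℝ = fromℚ 0ℚ
1ℝ = fromℚ 1ℚ

infixl 6 _+_ _-_
infixl 7 _*_
infix  8 -_

_+_ : ℝ → ℝ → ℝ
mkℝ x cx + mkℝ y cy = mkℝ (λ n → x n ℚ.+ y n) λ ε 0<ε →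
  let (M , p) = cx (½ ℚ.* ε) (0<½* 0<ε)
      (N , q) = cy (½ ℚ.* ε) (0<½* 0<ε)
  in M ⊔ N , λ m n m≥ n≥ →
    subst (λ z → ∣ z ∣ ℚ.< ε) (sym (diff-of-sums (x m) (y m) (x n) (y n)))
      (∣+∣<-halves (x m ℚ.- x n) (y m ℚ.- y n)
        (p m n (ℕ.m⊔n≤o⇒m≤o M N m≥) (ℕ.m⊔n≤o⇒m≤o M N n≥))
        (q m n (ℕ.m⊔n≤o⇒n≤o M N m≥) (ℕ.m⊔n≤o⇒n≤o M N n≥)))

-_ : ℝ → ℝ
- mkℝ x cx = mkℝ (λ n → ℚ.- x n) λ ε 0<ε →
  let (N , p) = cx ε 0<ε
  in N , λ m n m≥ n≥ →
    subst (ℚ._< ε)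
      (sym (trans (cong ∣_∣ (neg-diff (x m) (x n))) (ℚ.∣-p∣≡∣p∣ (x m ℚ.- x n))))
      (p m n m≥ n≥)

_-_ : ℝ → ℝ → ℝ
x - y = x + (- y)

eventually-bounded : ∀ {x} → Cauchy x →
  ∃[ B ] 0ℚ ℚ.< B × ∃[ N ] ∀ n → N ℕ.≤ n → ∣ x n ∣ ℚ.< B
eventually-bounded {x} cx = B , 0<B , N , bound
  where
  N = proj₁ (cx 1ℚ (ℚ.positive⁻¹ 1ℚ))
  near = proj₂ (cx 1ℚ (ℚ.positive⁻¹ 1ℚ))
  B = 1ℚ ℚ.+ ∣ x N ∣
  0<B : 0ℚ ℚ.< B
  0<B = ℚ.+-mono-<-≤ (ℚ.positive⁻¹ 1ℚ) (ℚ.0≤∣p∣ (x N))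
  bound : ∀ n → N ℕ.≤ n → ∣ x n ∣ ℚ.< B
  bound n n≥ = ℚ.≤-<-trans
    (subst (λ z → ∣ z ∣ ℚ.≤ ∣ x n ℚ.- x N ∣ ℚ.+ ∣ x N ∣) (cancel-diff (x n) (x N))
      (ℚ.∣p+q∣≤∣p∣+∣q∣ (x n ℚ.- x N) (x N)))
    (ℚ.+-monoˡ-< ∣ x N ∣ (near n N n≥ ℕ.≤-refl))

∣*∣<-* : ∀ {B δ} a b → 0ℚ ℚ.< B → ∣ a ∣ ℚ.< B → ∣ b ∣ ℚ.< δ → ∣ a ℚ.* b ∣ ℚ.< B ℚ.* δ
∣*∣<-* {B} {δ} a b 0<B a< b< = subst (ℚ._< B ℚ.* δ) (sym (ℚ.∣p*q∣≡∣p∣*∣q∣ a b))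
  (ℚ.≤-<-trans
    (ℚ.*-monoʳ-≤-nonNeg ∣ b ∣ {{ℚ.nonNegative (ℚ.0≤∣p∣ b)}} (ℚ.<⇒≤ a<))
    (ℚ.*-monoʳ-<-pos B {{ℚ.positive 0<B}} b<))

_*_ : ℝ → ℝ → ℝ
mkℝ x cx * mkℝ y cy = mkℝ (λ n → x n ℚ.* y n) λ ε 0<ε →
  let (B , 0<B , K , x<B) = eventually-bounded cx
      (C , 0<C , L , y<C) = eventually-bounded cy
      η     = ½ ℚ.* ε
      (δ , 0<δ , Bδ≡η) = divide B η 0<B (0<½* 0<ε)
      (γ , 0<γ , Cγ≡η) = divide C η 0<C (0<½* 0<ε)
      (M , p) = cx γ 0<γ
      (N , q) = cy δ 0<δ
  in (K ⊔ L) ⊔ (M ⊔ N) , λ m n m≥ n≥ →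
    let KLm = ℕ.m⊔n≤o⇒m≤o (K ⊔ L) (M ⊔ N) m≥
        KLn = ℕ.m⊔n≤o⇒m≤o (K ⊔ L) (M ⊔ N) n≥
        MNm = ℕ.m⊔n≤o⇒n≤o (K ⊔ L) (M ⊔ N) m≥
        MNn = ℕ.m⊔n≤o⇒n≤o (K ⊔ L) (M ⊔ N) n≥
        dy  = q m n (ℕ.m⊔n≤o⇒n≤o M N MNm) (ℕ.m⊔n≤o⇒n≤o M N MNn)
        dx  = p m n (ℕ.m⊔n≤o⇒m≤o M N MNm) (ℕ.m⊔n≤o⇒m≤o M N MNn)
    in subst (λ z → ∣ z ∣ ℚ.< ε) (sym (diff-of-products (x m) (y m) (x n) (y n)))
      (∣+∣<-halves (x m ℚ.* (y m ℚ.- y n)) (y n ℚ.* (x m ℚ.- x n))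
        (subst (∣ x m ℚ.* (y m ℚ.- y n) ∣ ℚ.<_) Bδ≡η
          (∣*∣<-* (x m) (y m ℚ.- y n) 0<B (x<B m (ℕ.m⊔n≤o⇒m≤o K L KLm)) dy))
        (subst (∣ y n ℚ.* (x m ℚ.- x n) ∣ ℚ.<_) Cγ≡η
          (∣*∣<-* (y n) (x m ℚ.- x n) 0<C (y<C n (ℕ.m⊔n≤o⇒n≤o K L KLn)) dx)))
  where
  divide : ∀ B η → 0ℚ ℚ.< B → 0ℚ ℚ.< η → ∃[ δ ] 0ℚ ℚ.< δ × B ℚ.* δ ≡ η
  divide B η 0<B 0<η = 1/B ℚ.* η , 0<1/B*η ,
    trans (sym (ℚ.*-assoc B 1/B η))
      (trans (cong (ℚ._* η) (ℚ.*-inverseʳ B {{B≢0}})) (ℚ.*-identityˡ η))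
    where
    B≢0 = ℚ.pos⇒nonZero B {{ℚ.positive 0<B}}
    1/B = ℚ.1/_ B {{B≢0}}
    0<1/B*η : 0ℚ ℚ.< 1/B ℚ.* η
    0<1/B*η = ℚ.positive⁻¹ (1/B ℚ.* η)
      {{ℚ.pos*pos⇒pos 1/B {{ℚ.1/pos⇒pos B {{ℚ.positive 0<B}}}} η {{ℚ.positive 0<η}}}}

≃-termwise : ∀ {x y} → (∀ n → seq x n ≡ seq y n) → x ≃ y
≃-termwise {x} {y} x≡y ε 0<ε = 0 , λ n _ →
  subst (ℚ._< ε)
    (sym (cong ∣_∣ (trans (cong (ℚ._- seq y n) (x≡y n)) (ℚ.+-inverseʳ (seq y n))))) 0<ε

≃-refl : ∀ {x} → x ≃ x
≃-refl {x} = ≃-termwise {x} {x} λ _ → refl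

≃-sym : ∀ {x y} → x ≃ y → y ≃ x
≃-sym {x} {y} x≃y ε 0<ε =
  let (N , p) = x≃y ε 0<ε
  in N , λ n n≥ → subst (ℚ._< ε) (∣swap∣ (seq x n) (seq y n)) (p n n≥)

≃-trans : ∀ {x y z} → x ≃ y → y ≃ z → x ≃ z
≃-trans {x} {y} {z} x≃y y≃z ε 0<ε =
  let (M , p) = x≃y (½ ℚ.* ε) (0<½* 0<ε)
      (N , q) = y≃z (½ ℚ.* ε) (0<½* 0<ε)
  in M ⊔ N , λ n n≥ →
    subst (λ w → ∣ w ∣ ℚ.< ε) (sym (split-diff (seq x n) (seq y n) (seq z n)))
      (∣+∣<-halves (seq x n ℚ.- seq y n) (seq y n ℚ.- seq z n)
        (p n (ℕ.m⊔n≤o⇒m≤o M N n≥)) (q n (ℕ.m⊔n≤o⇒n≤o M N n≥)))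

+-cong : ∀ {x x′ y y′} → x ≃ x′ → y ≃ y′ → x + y ≃ x′ + y′
+-cong {x} {x′} {y} {y′} x≃x′ y≃y′ ε 0<ε =
  let (M , p) = x≃x′ (½ ℚ.* ε) (0<½* 0<ε)
      (N , q) = y≃y′ (½ ℚ.* ε) (0<½* 0<ε)
  in M ⊔ N , λ n n≥ →
    subst (λ w → ∣ w ∣ ℚ.< ε)
      (sym (diff-of-sums (seq x n) (seq y n) (seq x′ n) (seq y′ n)))
      (∣+∣<-halves (seq x n ℚ.- seq x′ n) (seq y n ℚ.- seq y′ n)
        (p n (ℕ.m⊔n≤o⇒m≤o M N n≥)) (q n (ℕ.m⊔n≤o⇒n≤o M N n≥)))

neg-cong : ∀ {x y} → x ≃ y → - x ≃ - y
neg-cong {x} {y} x≃y ε 0<ε =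
  let (N , p) = x≃y ε 0<ε
  in N , λ n n≥ → subst (ℚ._< ε)
    (sym (trans (cong ∣_∣ (neg-diff (seq x n) (seq y n)))
                (ℚ.∣-p∣≡∣p∣ (seq x n ℚ.- seq y n))))
    (p n n≥)

infix 4 _≡_[mod1]

_≡_[mod1] : ℝ → ℝ → Set
x ≡ y [mod1] = ∃[ n ] x - y ≃ fromℤ n

mod1-refl : ∀ {x} → x ≡ x [mod1]
mod1-refl {x} = ℤ.0ℤ , ≃-termwise {x - x} {fromℤ ℤ.0ℤ} λ n → ℚ.+-inverseʳ (seq x n)

mod1-sym : ∀ {x y} → x ≡ y [mod1] → y ≡ x [mod1]
mod1-sym {x} {y} (n , x-y≃n) = ℤ.- n ,
  ≃-trans {y - x} {(- (x - y))} {fromℤ (ℤ.- n)}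
    (≃-termwise {y - x} {(- (x - y))} λ i → swap-diff (seq y i) (seq x i))
    (≃-trans {(- (x - y))} {(- fromℤ n)} {fromℤ (ℤ.- n)}
      (neg-cong {x - y} {fromℤ n} x-y≃n)
      (≃-termwise {(- fromℤ n)} {fromℤ (ℤ.- n)} λ _ → sym (/1-homo-neg n)))

mod1-trans : ∀ {x y z} → x ≡ y [mod1] → y ≡ z [mod1] → x ≡ z [mod1]
mod1-trans {x} {y} {z} (m , x-y≃m) (n , y-z≃n) = m ℤ.+ n ,
  ≃-trans {x - z} {(x - y) + (y - z)} {fromℤ (m ℤ.+ n)}
    (≃-termwise {x - z} {(x - y) + (y - z)} λ i → split-diff (seq x i) (seq y i) (seq z i))
    (≃-trans {(x - y) + (y - z)} {fromℤ m + fromℤ n} {fromℤ (m ℤ.+ n)}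
      (+-cong {x - y} {fromℤ m} {y - z} {fromℤ n} x-y≃m y-z≃n)
      (≃-termwise {fromℤ m + fromℤ n} {fromℤ (m ℤ.+ n)} λ _ → sym (/1-homo-+ m n)))

-- A point of the circle is given by any real representative.
C : Setoid 0ℓ 0ℓ
C = record
  { Carrier       = ℝ
  ; _≈_           = _≡_[mod1]
  ; isEquivalence = record
    { refl  = λ {x} → mod1-refl {x}
    ; sym   = λ {x} {y} → mod1-sym {x} {y}
    ; trans = λ {x} {y} {z} → mod1-trans {x} {y} {z}
    }
  }

module C = Setoid C

infix 4 _∈ᴵ_ _∈_ _∉_

data EndpointKind : Set where
  included excluded : EndpointKind

record Interval : Set where
  field
    left right         : ℝ
    leftKind rightKind : EndpointKind

  length : ℝ
  length = right - left

boundedBy : EndpointKind → ℝ → ℝ → Set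
boundedBy included x y = x ≤ y
boundedBy excluded x y = x < y

_∈ᴵ_ : ℝ → Interval → Set
x ∈ᴵ I = boundedBy leftKind left x × boundedBy rightKind x right
  where open Interval I

record Arc : Set where
  field
    interval : Interval
  open Interval interval public using (length)
  field
    0<length : 0ℝ < length
    length≤1 : length ≤ 1ℝ

_∈_ : C.Carrier → Arc → Set
p ∈ A = ∃[ x ] x ∈ᴵ Arc.interval A × x C.≈ p

_∉_ : C.Carrier → Arc → Set
p ∉ A = ¬ (p ∈ A)

position : (v : ℝ) (β : C.Carrier) (t : ℝ) → C.Carrier
position v β t = v * t + β

{-# OPTIONS --safe #-}
module Submission where

-- A runner of integer speed j returns to its position at integer time steps, and
-- it stays in a gap of length δ during a time δ / j. So runner 1 can guard the
-- complement of A during [0, δ], runner 2 during [δ, δ + δ/2], and so on, each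
-- modulo 1. Since the harmonic series diverges, finitely many runners guard all
-- times in [0, 1], and hence all times.

open import Data.Fin.Base using (Fin; toℕ; fromℕ<)
import Data.Fin.Properties as Fin
open import Data.Integer.Base as ℤ using (ℤ; +_; +[1+_]; -[1+_])
import Data.Integer.DivMod as ℤ
import Data.Integer.Properties as ℤ
open import Data.Nat.Base as ℕ using (ℕ; zero; suc; _⊔_)
open import Data.Nat.Coprimality using (1-coprimeTo)
import Data.Nat.Coprimality as Coprime
import Data.Nat.Properties as ℕ
open import Data.Product.Base using (Σ-syntax; ∃-syntax; _×_; _,_; proj₁; proj₂)
open import Data.Rational.Base as ℚ using (ℚ; 0ℚ; 1ℚ; ½; ∣_∣; mkℚ; *≤*; *<*)
import Data.Rational.Properties as ℚ
open import Data.Rational.Solver using (module +-*-Solver)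
open import Data.Sum.Base using (inj₁; inj₂)
open import Function.Definitions using (Injective)
open import Relation.Binary.PropositionalEquality
  using (_≡_; refl; sym; trans; cong; cong₂; subst; subst₂)
open import Relation.Nullary.Decidable using (yes; no)
open import Relation.Nullary.Negation using (¬_; contradiction)
open import Defs

open +-*-Solver using (solve; con; _:=_; _:+_; _:*_; _:-_; :-_)

-- Integers as rationals, floors and absolute values

int : ℤ → ℚ
int i = i ℚ./ 1

-- `i / 1` does not compute for a variable `i`; on this normal form, order and products reduce to
-- those of integers.
int≡mkℚ : ∀ i → int i ≡ mkℚ i 0 (Coprime.sym (1-coprimeTo ℤ.∣ i ∣))
int≡mkℚ i = ℚ.↥p/↧p≡p (mkℚ i 0 (Coprime.sym (1-coprimeTo ℤ.∣ i ∣)))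

int-homo-* : ∀ m n → int (m ℤ.* n) ≡ int m ℚ.* int n
int-homo-* m n = sym (cong₂ ℚ._*_ (int≡mkℚ m) (int≡mkℚ n))

int-mono-≤ : ∀ {m n} → m ℤ.≤ n → int m ℚ.≤ int n
int-mono-≤ {m} {n} m≤n = subst₂ ℚ._≤_ (sym (int≡mkℚ m)) (sym (int≡mkℚ n))
  (*≤* (ℤ.*-monoʳ-≤-nonNeg (+ 1) m≤n))

int-injective : ∀ {m n} → int m ≡ int n → m ≡ n
int-injective {m} {n} eq =
  cong ℚ.numerator (trans (sym (int≡mkℚ m)) (trans eq (int≡mkℚ n)))

floor≤ : ∀ q → int (ℚ.floor q) ℚ.≤ q
floor≤ q@(mkℚ a d _) = subst (ℚ._≤ q) (sym (int≡mkℚ (ℚ.floor q)))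
  (*≤* (subst (ℚ.floor q ℤ.* +[1+ d ] ℤ.≤_) (sym (ℤ.*-identityʳ a))
    (ℤ.[n/d]*d≤n a +[1+ d ])))

<floor+1 : ∀ q → q ℚ.< int (ℤ.suc (ℚ.floor q))
<floor+1 q@(mkℚ a d _) = subst (q ℚ.<_) (sym (int≡mkℚ (ℤ.suc (ℚ.floor q))))
  (*<* (subst₂ ℤ._<_ (sym (ℤ.*-identityʳ a))
    (cong (λ z → ℤ.suc z ℤ.* +[1+ d ]) (sym (ℤ.div-pos-is-/ℕ a (suc d))))
    (ℤ.n<s[n/ℕd]*d a (suc d))))

p≤∣p∣ : ∀ p → p ℚ.≤ ∣ p ∣
p≤∣p∣ p with ℚ.≤-total 0ℚ p
... | inj₁ 0≤p = ℚ.≤-reflexive (sym (ℚ.0≤p⇒∣p∣≡p 0≤p))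
... | inj₂ p≤0 = ℚ.≤-trans p≤0 (ℚ.0≤∣p∣ p)

∣p∣<q⇒p<q : ∀ {p q} → ∣ p ∣ ℚ.< q → p ℚ.< q
∣p∣<q⇒p<q {p} = ℚ.≤-<-trans (p≤∣p∣ p)

∣p∣<q⇒-p<q : ∀ {p q} → ∣ p ∣ ℚ.< q → ℚ.- p ℚ.< q
∣p∣<q⇒-p<q {p} {q} ∣p∣<q =
  ∣p∣<q⇒p<q (subst (ℚ._< q) (sym (ℚ.∣-p∣≡∣p∣ p)) ∣p∣<q)

-- Integer speeds and their periods

speed : ℕ → ℚ
speed i = int +[1+ i ]

period : ℕ → ℚ
period i = mkℚ (+ 1) i (1-coprimeTo (suc i))

speed*period : ∀ i → speed i ℚ.* period i ≡ 1ℚ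
speed*period i = trans (cong (ℚ._* period i) (int≡mkℚ +[1+ i ]))
  (ℚ.*-inverseʳ (mkℚ +[1+ i ] 0 (Coprime.sym (1-coprimeTo (suc i)))))

speed*[δ*period] : ∀ δ i → speed i ℚ.* (δ ℚ.* period i) ≡ δ
speed*[δ*period] δ i = trans
  (solve 3 (λ v d u → v :* (d :* u) := d :* (v :* u)) refl (speed i) δ (period i))
  (trans (cong (δ ℚ.*_) (speed*period i)) (ℚ.*-identityʳ δ))

0<speed : ∀ i → 0ℚ ℚ.< speed i
0<speed i = subst (0ℚ ℚ.<_) (sym (int≡mkℚ +[1+ i ])) (ℚ.positive⁻¹ _)

period-antitone : ∀ {i j} → i ℕ.≤ j → period j ℚ.≤ period i
period-antitone i≤j = *≤* (ℤ.*-monoˡ-≤-nonNeg (+ 1) (ℤ.+≤+ (ℕ.s≤s i≤j)))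

-- Divergence of the harmonic series

harmonic : ℕ → ℚ
harmonic zero    = 0ℚ
harmonic (suc i) = harmonic i ℚ.+ period i

-- The `m` added terms have indices at most `N`, so each is at least `period N`.
harmonic-increment : ∀ k m N → k ℕ.+ m ℕ.≤ suc N →
  harmonic k ℚ.+ int (+ m) ℚ.* period N ℚ.≤ harmonic (k ℕ.+ m)
harmonic-increment k zero N _ = ℚ.≤-reflexive (trans
  (solve 2 (λ h u → h :+ con 0ℚ :* u := h) refl (harmonic k) (period N))
  (cong harmonic (sym (ℕ.+-identityʳ k))))
harmonic-increment k (suc m) N k+m≤N rewrite ℕ.+-suc k m = subst (ℚ._≤ _)
  (trans
    (solve 3 (λ h i u → (h :+ i :* u) :+ u := h :+ (con 1ℚ :+ i) :* u) refl
      (harmonic k) (int (+ m)) (period N))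
    (cong (λ i → harmonic k ℚ.+ i ℚ.* period N) (sym (/1-homo-+ (+ 1) (+ m)))))
  (ℚ.+-mono-≤
    (harmonic-increment k m N (ℕ.≤-trans (ℕ.n≤1+n _) k+m≤N))
    (period-antitone (ℕ.s≤s⁻¹ k+m≤N)))

-- Oresme's argument: each of the `k + 1` new terms is at least 1 / (2k + 2).
harmonic-doubling : ∀ k → harmonic (suc k) ℚ.+ ½ ℚ.≤ harmonic (suc k ℕ.+ suc k)
harmonic-doubling k =
  subst (λ p → harmonic (suc k) ℚ.+ p ℚ.≤ harmonic (suc k ℕ.+ suc k)) half
    (harmonic-increment (suc k) (suc k) (k ℕ.+ suc k) ℕ.≤-refl)
  where
  u = period (k ℕ.+ suc k)
  half : speed k ℚ.* u ≡ ½
  half = trans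
    (solve 2 (λ v w → v :* w := con ½ :* ((v :+ v) :* w)) refl (speed k) u)
    (trans
      (cong (λ v → ½ ℚ.* (v ℚ.* u)) (sym (/1-homo-+ +[1+ k ] +[1+ k ])))
      (cong (½ ℚ.*_) (speed*period (k ℕ.+ suc k))))

-- Start with one term and double the number of terms `m` times.
harmonic-unbounded : ∀ m → ∃[ k ] ½ ℚ.* int (+ m) ℚ.≤ harmonic (suc k)
harmonic-unbounded zero = 0 , *≤* (ℤ.+≤+ ℕ.z≤n)
harmonic-unbounded (suc m) =
  let (k , m≤) = harmonic-unbounded m
  in k ℕ.+ suc k , subst (ℚ._≤ harmonic (suc k ℕ.+ suc k))
    (trans
      (solve 1 (λ i → con ½ :* i :+ con ½ := con ½ :* (con 1ℚ :+ i)) refl (int (+ m)))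
      (cong (½ ℚ.*_) (sym (/1-homo-+ (+ 1) (+ m)))))
    (ℚ.≤-trans (ℚ.+-monoˡ-≤ ½ m≤) (harmonic-doubling k))

-- The denominator is large enough, since a positive numerator is at least 1.
archimedean : ∀ p → 0ℚ ℚ.< p → ∃[ d ] 1ℚ ℚ.≤ speed d ℚ.* p
archimedean p@(mkℚ +[1+ n ] d _) _ = d , subst (ℚ._≤ speed d ℚ.* p) (speed*period d)
  (ℚ.*-monoˡ-≤-nonNeg (speed d) {{ℚ.nonNegative (ℚ.<⇒≤ (0<speed d))}} period≤p)
  where
  period≤p : period d ℚ.≤ p
  period≤p = *≤* (ℤ.*-monoʳ-≤-nonNeg +[1+ d ] {+ 1} {+[1+ n ]} (ℤ.+≤+ (ℕ.s≤s ℕ.z≤n)))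
archimedean (mkℚ (+ zero) _ _) (*<* (ℤ.+<+ ()))
archimedean (mkℚ -[1+ _ ] _ _) (*<* ())

harmonic-exceeds : ∀ δ → 0ℚ ℚ.< δ → ∃[ k ] 1ℚ ℚ.≤ δ ℚ.* harmonic k
harmonic-exceeds δ 0<δ =
  let (d , 1≤) = archimedean (½ ℚ.* δ) (0<½* 0<δ)
      (k , m≤) = harmonic-unbounded (suc d)
  in suc k , ℚ.≤-trans 1≤ (subst (ℚ._≤ δ ℚ.* harmonic (suc k))
    (solve 2 (λ e v → e :* (con ½ :* v) := v :* (con ½ :* e)) refl δ (speed d))
    (ℚ.*-monoˡ-≤-nonNeg δ {{ℚ.nonNegative (ℚ.<⇒≤ 0<δ)}} m≤))

-- A downward search from `k` stops at the largest index `i` with `s i ≤ f`.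
bracket : ∀ (s : ℕ → ℚ) k {f} → s 0 ℚ.≤ f → f ℚ.< s k →
  ∃[ i ] i ℕ.< k × s i ℚ.≤ f × f ℚ.< s (suc i)
bracket s zero s₀≤f f<s₀ = contradiction (ℚ.≤-<-trans s₀≤f f<s₀) (ℚ.<-irrefl refl)
bracket s (suc k) {f} s₀≤f f<sₖ₊₁ with f ℚ.<? s k
... | no f≮sₖ = k , ℕ.≤-refl , ℚ.≮⇒≥ f≮sₖ , f<sₖ₊₁
... | yes f<sₖ =
  let (i , i<k , p) = bracket s k s₀≤f f<sₖ
  in i , ℕ.m<n⇒m<1+n i<k , p

-- Real inequalities at late terms of the sequences

Eventually : (ℕ → Set) → Set
Eventually P = ∃[ N ] ∀ n → N ℕ.≤ n → P n

infixr 4 _&_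

_&_ : ∀ {P Q} → Eventually P → Eventually Q → Eventually (λ n → P n × Q n)
(M , p) & (N , q) = M ⊔ N , λ n n≥ →
  p n (ℕ.m⊔n≤o⇒m≤o M N n≥) , q n (ℕ.m⊔n≤o⇒n≤o M N n≥)

-- Reduces a contradiction between reals to one between rationals, at an index where all estimates
-- hold.
¬eventually : ∀ {P} → Eventually P → ¬ (∀ n → ¬ P n)
¬eventually (N , p) ¬p = ¬p N (p N ℕ.≤-refl)

-- Open and closed ends can be treated alike, because the guard keeps a positive distance from both
-- ends of the arc.
boundedBy⇒≤ : ∀ kind {x y} → boundedBy kind x y → x ≤ y
boundedBy⇒≤ included x≤y = x≤y
boundedBy⇒≤ excluded {x} {y} (η , 0<η , N , x+η<y) ε 0<ε = N , λ n n≥ →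
  ℚ.<-trans (subst (ℚ._< seq x n ℚ.+ η) (ℚ.+-identityʳ (seq x n)) (ℚ.+-monoʳ-< (seq x n) 0<η))
    (ℚ.<-trans (x+η<y n n≥)
      (subst (ℚ._< seq y n ℚ.+ ε) (ℚ.+-identityʳ (seq y n)) (ℚ.+-monoʳ-< (seq y n) 0<ε)))

fromℚ-positive : ∀ {q} → 0ℚ ℚ.< q → 0ℝ < fromℚ q
fromℚ-positive {q} 0<q = ½ ℚ.* q , 0<½* 0<q , 0 , λ _ _ →
  subst₂ ℚ._<_ (sym (ℚ.+-identityˡ (½ ℚ.* q))) (half+half q)
    (subst (ℚ._< ½ ℚ.* q ℚ.+ ½ ℚ.* q) (ℚ.+-identityʳ (½ ℚ.* q))
      (ℚ.+-monoʳ-< (½ ℚ.* q) (0<½* 0<q)))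

fromℚ-injective : ∀ {p q} → fromℚ p ≃ fromℚ q → p ≡ q
fromℚ-injective {p} {q} p≃q with 0ℚ ℚ.<? ∣ p ℚ.- q ∣
-- The distance itself is taken as the tolerance and would be less than itself.
... | yes 0<d =
  let (N , d<d) = p≃q ∣ p ℚ.- q ∣ 0<d
  in contradiction (d<d N ℕ.≤-refl) (ℚ.<-irrefl refl)
... | no 0≮d = x∙y⁻¹≈ε⇒x≈y p q (ℚ.∣p∣≡0⇒p≡0 (p ℚ.- q)
  (ℚ.≤-antisym (ℚ.≮⇒≥ 0≮d) (ℚ.0≤∣p∣ (p ℚ.- q))))
  where open import Algebra.Properties.Group ℚ.+-0-group using (x∙y⁻¹≈ε⇒x≈y)

-- Rational estimates for a runner in the gap

-- Integers w ≥ 0 put x beyond the right end r of the arc, and w ≤ -1 puts it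
-- before the left end l ≈ r - ℓ.
translate-misses-arc : ∀ {δ r l ℓ x c} w →
  ℓ ℚ.+ int (+ 8) ℚ.* δ ℚ.< 1ℚ → ∣ (r ℚ.- l) ℚ.- ℓ ∣ ℚ.< δ →
  r ℚ.+ int (+ 2) ℚ.* δ ℚ.< c → c ℚ.< r ℚ.+ int (+ 5) ℚ.* δ →
  ∣ x ℚ.- (c ℚ.+ int w) ∣ ℚ.< δ → l ℚ.< x ℚ.+ δ → ¬ (x ℚ.< r ℚ.+ δ)
translate-misses-arc {δ} {r} {l} {ℓ} {x} {c} w@(+ _) _ _ lo _ near _ x<r+δ =
  ℚ.<-irrefl
    (solve 5 (λ δ r x c w →
      (:- (x :- (c :+ w)) :+ con 0ℚ) :+ ((r :+ con (int (+ 2)) :* δ) :+ x)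
      := (δ :+ w) :+ (c :+ (r :+ δ))) refl δ r x c (int w))
    (ℚ.+-mono-<
      (ℚ.+-mono-<-≤ (∣p∣<q⇒-p<q near) (int-mono-≤ {+ 0} {w} (ℤ.+≤+ ℕ.z≤n)))
      (ℚ.+-mono-< lo x<r+δ))
translate-misses-arc {δ} {r} {l} {ℓ} {x} {c} w@(-[1+ _ ]) slack len _ hi near l<x+δ _ =
  -- All estimates add up to a strict inequality between equal sides. The 8δ are the 5δ of the bound
  -- on `c` and one δ each from `near`, `l<x+δ` and `len`.
  ℚ.<-irrefl
    (solve 7 (λ δ r l ℓ x c w →
      ((x :- (c :+ w)) :+ w) :+ ((c :+ l) :+ ((r :- l :- ℓ) :+ (ℓ :+ con (int (+ 8)) :* δ)))
      := (δ :+ con (int -[1+ 0 ])) :+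
         (((r :+ con (int (+ 5)) :* δ) :+ (x :+ δ)) :+ (δ :+ con 1ℚ))) refl δ r l ℓ x c (int w))
    (ℚ.+-mono-<
      (ℚ.+-mono-<-≤ (∣p∣<q⇒p<q near) (int-mono-≤ {w} { -[1+ 0 ]} (ℤ.-≤- ℕ.z≤n)))
      (ℚ.+-mono-< (ℚ.+-mono-< hi l<x+δ) (ℚ.+-mono-< (∣p∣<q⇒p<q len) slack)))

-- The runner passes r + 3δ at time m + t₀; by time q it has run a distance
-- v ((q - m) - t₀), and q approximates the actual time τ.
position-in-gap : ∀ δ r v τ q m t₀ →
  let c = v ℚ.* τ ℚ.+ (r ℚ.+ (int (+ 3) ℚ.* δ ℚ.- v ℚ.* t₀)) ℚ.- v ℚ.* m in
  ∣ v ℚ.* (τ ℚ.- q) ∣ ℚ.< δ →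
  0ℚ ℚ.≤ v ℚ.* ((q ℚ.- m) ℚ.- t₀) → v ℚ.* ((q ℚ.- m) ℚ.- t₀) ℚ.< δ →
  r ℚ.+ int (+ 2) ℚ.* δ ℚ.< c × c ℚ.< r ℚ.+ int (+ 5) ℚ.* δ
position-in-gap δ r v τ q m t₀ error 0≤run run<δ =
  -- Around the offset 3δ the time error moves the runner by less than δ either way, and the run
  -- adds less than δ: hence 2δ and 5δ.
  subst₂ ℚ._<_
    (solve 4 (λ δ r v s → (:- (v :* s) :+ con 0ℚ) :+ (r :+ con (int (+ 2)) :* δ :+ v :* s)
      := r :+ con (int (+ 2)) :* δ) refl δ r v (τ ℚ.- q))
    (solve 7 (λ δ r v τ q m t₀ →
      (δ :+ v :* ((q :- m) :- t₀)) :+ (r :+ con (int (+ 2)) :* δ :+ v :* (τ :- q))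
      := v :* τ :+ (r :+ (con (int (+ 3)) :* δ :- v :* t₀)) :- v :* m) refl δ r v τ q m t₀)
    (ℚ.+-monoˡ-< (r ℚ.+ int (+ 2) ℚ.* δ ℚ.+ v ℚ.* (τ ℚ.- q))
      (ℚ.+-mono-<-≤ (∣p∣<q⇒-p<q error) 0≤run)) ,
  subst₂ ℚ._<_
    (solve 7 (λ δ r v τ q m t₀ →
      (v :* (τ :- q) :+ v :* ((q :- m) :- t₀)) :+ (r :+ con (int (+ 3)) :* δ)
      := v :* τ :+ (r :+ (con (int (+ 3)) :* δ :- v :* t₀)) :- v :* m) refl δ r v τ q m t₀)
    (solve 2 (λ δ r → (δ :+ δ) :+ (r :+ con (int (+ 3)) :* δ)
      := r :+ con (int (+ 5)) :* δ) refl δ r)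
    (ℚ.+-monoˡ-< (r ℚ.+ int (+ 3) ℚ.* δ) (ℚ.+-mono-< (∣p∣<q⇒p<q error) run<δ))

theorem1 : ∀ (ℓ : ℝ) → 0ℝ < ℓ → ℓ < 1ℝ →
    Σ[ k ∈ ℕ ] (∀ (A : Arc) → Arc.length A ≃ ℓ →
    Σ[ v ∈ (Fin k → ℝ) ] Σ[ β ∈ (Fin k → C.Carrier) ]
    ( (∀ i → 0ℝ < v i)
    × Injective _≡_ _≃_ v
    × (∀ (t : ℝ) → 0ℝ ≤ t → Σ[ i ∈ Fin k ] position (v i) (β i) t ∉ A)))
theorem1 ℓ _ (ε , 0<ε , ℓ+ε<1) = k , λ A ∣A∣≃ℓ → v , β A , v-positive , v-injective ,
  λ t _ → let (i , i<k , guards) = guard t in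
    fromℕ< i<k , subst (λ j → position (fromℚ (speed j)) (start A j) t ∉ A)
      (sym (Fin.toℕ-fromℕ< i<k)) (guard-avoids A ∣A∣≃ℓ t i guards)
  where
  -- An eighth of the slack `ε` between `ℓ` and 1, matching the 8δ spent at the left end of the arc.
  δ : ℚ
  δ = ½ ℚ.* (½ ℚ.* (½ ℚ.* ε))

  0<δ : 0ℚ ℚ.< δ
  0<δ = 0<½* (0<½* (0<½* 0<ε))

  ε≡8δ : ε ≡ int (+ 8) ℚ.* δ
  ε≡8δ = solve 1 (λ e → e := con (int (+ 8)) :* (con ½ :* (con ½ :* (con ½ :* e)))) refl ε

  -- Fixed before any arc is given: the watches of the `k` runners last `δ * harmonic k` in total,
  -- at least one unit of time.
  k : ℕ
  k = proj₁ (harmonic-exceeds δ 0<δ)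

  shift : ℕ → ℚ
  shift i = δ ℚ.* harmonic i

  -- Chosen so that at time `shift i`, when its watch begins, runner `i` is 3δ past the right end of
  -- the arc.
  start : Arc → ℕ → ℝ
  start A i = Interval.right (Arc.interval A)
    + fromℚ (int (+ 3) ℚ.* δ ℚ.- speed i ℚ.* shift i)

  v : Fin k → ℝ
  v i = fromℚ (speed (toℕ i))

  β : Arc → Fin k → ℝ
  β A i = start A (toℕ i)

  v-positive : ∀ i → 0ℝ < v i
  v-positive i = fromℚ-positive (0<speed (toℕ i))

  v-injective : Injective _≡_ _≃_ v
  v-injective {i} {j} vᵢ≃vⱼ = Fin.toℕ-injective
    (ℤ.+[1+-injective (int-injective
      (fromℚ-injective {speed (toℕ i)} {speed (toℕ j)} vᵢ≃vⱼ)))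

  -- Runner i is responsible for the times in [shift i, shift (suc i)] + m.
  Guards : ℕ → ℝ → Set
  Guards i t = ∃[ q ] ∃[ m ] shift i ℚ.≤ q ℚ.- int m × q ℚ.- int m ℚ.< shift (suc i)
    × Eventually λ n → ∣ seq t n ℚ.- q ∣ ℚ.< δ ℚ.* period i

  -- Floor and `i` are chosen by deciding inequalities, so a rational term `q` replaces `t`. The
  -- tolerance `δ * period k` is fixed before `i` is known and is at most `δ * period i` for every
  -- `i < k`.
  guard : ∀ t → ∃[ i ] i ℕ.< k × Guards i t
  guard t =
    let (i , i<k , lo , hi) = bracket shift k 0≤f f<shift
    in i , i<k , q , m , lo , hi , N , λ n n≥ →
      ℚ.<-≤-trans (close n N n≥ ℕ.≤-refl)
        (ℚ.*-monoˡ-≤-nonNeg δ {{ℚ.nonNegative (ℚ.<⇒≤ 0<δ)}} (period-antitone (ℕ.<⇒≤ i<k)))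
    where
    0<δ*period : 0ℚ ℚ.< δ ℚ.* period k
    0<δ*period = ℚ.positive⁻¹ (δ ℚ.* period k)
      {{ℚ.pos*pos⇒pos δ {{ℚ.positive 0<δ}} (period k)}}
    N     = proj₁ (cauchy t (δ ℚ.* period k) 0<δ*period)
    close = proj₂ (cauchy t (δ ℚ.* period k) 0<δ*period)
    q     = seq t N
    m     = ℚ.floor q
    0≤f : shift 0 ℚ.≤ q ℚ.- int m
    0≤f = subst₂ ℚ._≤_
      (trans (ℚ.+-inverseʳ (int m)) (sym (ℚ.*-zeroʳ δ))) refl
      (ℚ.+-monoˡ-≤ (ℚ.- int m) (floor≤ q))
    f<1 : q ℚ.- int m ℚ.< 1ℚ
    f<1 = subst (q ℚ.- int m ℚ.<_)
      (trans (cong (ℚ._- int m) (/1-homo-+ (+ 1) m))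
        (solve 1 (λ m → (con 1ℚ :+ m) :- m := con 1ℚ) refl (int m)))
      (ℚ.+-monoˡ-< (ℚ.- int m) (<floor+1 q))
    f<shift : q ℚ.- int m ℚ.< shift k
    f<shift = ℚ.<-≤-trans f<1 (proj₂ (harmonic-exceeds δ 0<δ))

  guard-avoids : ∀ A → Arc.length A ≃ ℓ → ∀ t i → Guards i t →
    position (fromℚ (speed i)) (start A i) t ∉ A
  guard-avoids A ∣A∣≃ℓ t i (q , m , lo , hi , t≈q) (x , (l≤x , x≤r) , z , x-p≃z) =
    ¬eventually
      (t≈q & ℓ+ε<1 & ∣A∣≃ℓ δ 0<δ & x-p≃z δ 0<δ
        & boundedBy⇒≤ leftKind {left} {x} l≤x δ 0<δ
        & boundedBy⇒≤ rightKind {x} {right} x≤r δ 0<δ)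
      λ n (τ≈q , ℓ+ε<1 , ∣A∣≈ℓ , x-p≈z , l<x+δ , x<r+δ) →
        let (above , below) = position-in-gap δ (seq right n) vᵢ (seq t n) q (int m) (shift i)
              (scaled τ≈q) 0≤run run<δ
        -- `z` is the integer by which `x` exceeds the position; the other summand counts the turns
        -- run in `m` units of time, whole because the speed is an integer.
        in translate-misses-arc {δ} {seq right n} {seq left n} {seq ℓ n} (z ℤ.+ +[1+ i ] ℤ.* m)
          (subst (λ p → seq ℓ n ℚ.+ p ℚ.< 1ℚ) ε≡8δ ℓ+ε<1) ∣A∣≈ℓ above below
          (subst (λ p → ∣ p ∣ ℚ.< δ) (laps (seq x n) (seq (position (fromℚ vᵢ) (start A i) t) n)) x-p≈z)
          l<x+δ x<r+δ
    where
    open Interval (Arc.interval A)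
    vᵢ = speed i
    instance
      vᵢ-positive : ℚ.Positive vᵢ
      vᵢ-positive = ℚ.positive (0<speed i)

    -- The time tolerance in `Guards` is divided by the speed, so the error in position is below δ
    -- for every runner.
    scaled : ∀ {s} → ∣ s ∣ ℚ.< δ ℚ.* period i → ∣ vᵢ ℚ.* s ∣ ℚ.< δ
    scaled {s} ∣s∣< = subst₂ ℚ._<_
      (trans (cong (ℚ._* ∣ s ∣) (sym (ℚ.0≤p⇒∣p∣≡p (ℚ.<⇒≤ (0<speed i)))))
        (sym (ℚ.∣p*q∣≡∣p∣*∣q∣ vᵢ s)))
      (speed*[δ*period] δ i)
      (ℚ.*-monoʳ-<-pos vᵢ ∣s∣<)

    0≤run : 0ℚ ℚ.≤ vᵢ ℚ.* ((q ℚ.- int m) ℚ.- shift i)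
    0≤run = subst (ℚ._≤ vᵢ ℚ.* ((q ℚ.- int m) ℚ.- shift i)) (ℚ.*-zeroʳ vᵢ)
      (ℚ.*-monoˡ-≤-nonNeg vᵢ {{ℚ.pos⇒nonNeg vᵢ}}
        (subst (ℚ._≤ (q ℚ.- int m) ℚ.- shift i) (ℚ.+-inverseʳ (shift i))
          (ℚ.+-monoˡ-≤ (ℚ.- shift i) lo)))

    -- The watch lasts `δ * period i`, in which the runner covers exactly δ.
    run<δ : vᵢ ℚ.* ((q ℚ.- int m) ℚ.- shift i) ℚ.< δ
    run<δ = subst (vᵢ ℚ.* ((q ℚ.- int m) ℚ.- shift i) ℚ.<_)
      (trans
        (cong (vᵢ ℚ.*_)
          (solve 3 (λ d h u → d :* (h :+ u) :- d :* h := d :* u) refl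
            δ (harmonic i) (period i)))
        (speed*[δ*period] δ i))
      (ℚ.*-monoʳ-<-pos vᵢ (ℚ.+-monoˡ-< (ℚ.- shift i) hi))

    laps : ∀ x p → (x ℚ.- p) ℚ.- int z ≡
      x ℚ.- ((p ℚ.- vᵢ ℚ.* int m) ℚ.+ int (z ℤ.+ +[1+ i ] ℤ.* m))
    laps x p = trans
      (solve 4 (λ x p z w → (x :- p) :- z := x :- ((p :- w) :+ (z :+ w))) refl
        x p (int z) (vᵢ ℚ.* int m))
      (cong (λ w → x ℚ.- ((p ℚ.- vᵢ ℚ.* int m) ℚ.+ w))
        (sym (trans (/1-homo-+ z (+[1+ i ] ℤ.* m))
          (cong (int z ℚ.+_) (int-homo-* +[1+ i ] m)))))
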